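{- Let $f(n,5,8)$ denote the minimum number of colors in an edge-coloring of the complete graph $K_n$ such that every copy of $K_5$ in $K_n$ receives at least $8$ distinct colors. Then $f(n,5,8)\le n+o(n)$ as $n\to\infty$.
   Context: A copy of $K_5$ receives at least $q$ colors if its $10$ edges carry at least $q$ distinct colors. -}

module Defs where

open import Data.Nat using (ℕ; _≤_)
open import Data.Fin using (Fin; zero; suc; _≟_)
open import Data.List using (List; []; _∷_; map; length; deduplicate)
open import Data.Product using (Σ; _×_; _,_)
open import Relation.Binary.PropositionalEquality using (_≡_)

v0 v1 v2 v3 v4 : Fin 5
v0 = zero
v1 = suc zero
v2 = suc (suc zero)
v3 = suc (suc (suc zero))
v4 = suc (suc (suc (suc zero)))

edgesK5 : List (Fin 5 × Fin 5)
edgesK5 =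
  (v0 , v1) ∷ (v0 , v2) ∷ (v0 , v3) ∷ (v0 , v4) ∷
  (v1 , v2) ∷ (v1 , v3) ∷ (v1 , v4) ∷
  (v2 , v3) ∷ (v2 , v4) ∷
  (v3 , v4) ∷ []

-- An edge-colouring of K_n with (at most) m colours: a symmetric map on
-- pairs of vertices (values on the diagonal are irrelevant).
EdgeColouring : ℕ → ℕ → Set
EdgeColouring n m =
  Σ (Fin n → Fin n → Fin m) (λ c → ∀ i j → c i j ≡ c j i)

coloursOnCopy : ∀ {n m} → EdgeColouring n m → (Fin 5 → Fin n) → ℕ
coloursOnCopy (c , _) v =
  length (deduplicate _≟_ (map (λ e → c (v (Data.Product.proj₁ e)) (v (Data.Product.proj₂ e))) edgesK5))

-- A copy of K_5 is an injective map Fin 5 → Fin n.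
Injective5 : ∀ {n} → (Fin 5 → Fin n) → Set
Injective5 v = ∀ a b → v a ≡ v b → a ≡ b

EveryK5AtLeast : ∀ {n m} → ℕ → EdgeColouring n m → Set
EveryK5AtLeast {n} q col = (v : Fin 5 → Fin n) → Injective5 v → q ≤ coloursOnCopy col v

-- f(n,5,q) ≤ m  iff  there is such a colouring with at most m colours
f5≤ : ℕ → ℕ → ℕ → Set
f5≤ n q m = Σ (EdgeColouring n m) (EveryK5AtLeast q)

{-# OPTIONS --safe #-}

-- On ℤ/q with q ≡ 3 (mod 4) prime, colour the pair {x , y} by a y + (1 - a) x, ordered so that
-- y - x is a square; this is symmetric because -1 is not a square. For (q , a) = (11 , 2) and
-- (23 , 6) the map (x , y) ↦ colour is a Latin square, and a finite check shows that no five
-- distinct vertices carry three disjoint pairs of equally coloured edges. The checked condition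
-- (that such coincidences force two prescribed vertices to be equal, for not necessarily distinct
-- vertices) passes to componentwise products, so 11^i 23^j colours suffice on 11^i 23^j vertices.
-- Since 11 and 23 are multiplicatively independent, every large n lies within a factor 1 + ε below
-- such a number.

module Submission where

open import Defs
open import Data.Bool using (true; false; if_then_else_)
open import Data.Bool.ListAction using (any)
open import Data.Fin using (Fin; zero; suc; _≟_; toℕ; fromℕ<; inject≤; inject₁; combine; remQuot)
open import Data.Fin.Induction using (<-weakInduction)
open import Data.Fin.Properties
  using (all?; pigeonhole; toℕ<n; toℕ-injective; toℕ-fromℕ<; inject≤-injective;
         combine-remQuot; combine-injectiveˡ; combine-injectiveʳ)
open import Data.List using (List; []; _∷_; map; length; filter; deduplicate)
open import Data.List.Membership.Propositional using (_∈_)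
open import Data.List.Properties using (filter-all)
open import Data.List.Relation.Unary.All as All using (All; []; _∷_)
import Data.List.Relation.Unary.All.Properties as All
open import Data.List.Relation.Unary.AllPairs using ([]; _∷_)
open import Data.List.Relation.Unary.Any as Any using (Any; here; there)
open import Data.List.Relation.Unary.Unique.Propositional using (Unique)
import Data.Nat as ℕ
open import Data.Nat
  using (ℕ; zero; suc; _+_; _*_; _∸_; _^_; _/_; _%_; _≤_; _<_; _>_; _≡ᵇ_; _≤ᵇ_; _≤?_;
         z≤n; s≤s; s≤s⁻¹; NonZero; >-nonZero)
open import Data.Nat.Divisibility using (_∣_; _∣?_; ∣-trans; m∣m*n; ∣1⇒≡1)
open import Data.Nat.DivMod using (_mod_; m≡m%n+[m/n]*n; m%n<n; m*n/n≡m; /-monoˡ-≤)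
open import Data.Nat.Primality using (Prime; prime?; euclidsLemma; ¬prime[1])
open import Data.Nat.Properties hiding (_≟_; _≤?_)
open import Data.Nat.Tactic.RingSolver using (solve-∀)
open import Data.Product using (Σ; ∃₂; _×_; _,_; proj₁; proj₂; swap)
open import Data.Product.Properties using (≡-dec)
open import Data.Sum as Sum using (_⊎_; inj₁; inj₂)
open import Data.Unit using (⊤; tt)
open import Data.Empty using (⊥)
open import Function using (_∘_)
open import Relation.Binary.Definitions using (Tri; tri<; tri≈; tri>)
open import Relation.Binary.PropositionalEquality
open import Relation.Nullary using (Dec; yes; no; ¬_; contradiction)
open import Relation.Nullary.Decidable
  using (_×-dec_; _⊎-dec_; _→-dec_; ¬?; from-yes; from-no)
open import Relation.Unary using (Decidable)

-- Edges and coincidences of colours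

-- For distinct vertices the alternatives are, up to relabelling, the four ways to place three
-- disjoint pairs of disjoint edges in `K_5`. All four share the first coincidence.
Pattern : ∀ {A : Set} → (A × A → A × A → Set) → A → A → A → A → A → Set
Pattern R u x y z w =
  R (u , x) (y , z) ×
  ((R (u , y) (x , z) × (R (u , z) (x , y) ⊎ R (u , z) (x , w))) ⊎
   (R (u , y) (x , w) × (R (u , z) (y , w) ⊎ R (x , z) (y , w))))

Pattern-map : ∀ {A B : Set} {R S} (f : A → B) →
              (∀ {a b c d} → R (a , b) (c , d) → S (f a , f b) (f c , f d)) →
              ∀ {u x y z w} → Pattern R u x y z w → Pattern S (f u) (f x) (f y) (f z) (f w)
Pattern-map f g (p , q) =
  g p , Sum.map (λ (r , s) → g r , Sum.map g g s) (λ (r , s) → g r , Sum.map g g s) q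

pattern? : ∀ {A : Set} {R : A × A → A × A → Set} → (∀ e f → Dec (R e f)) →
           ∀ u x y z w → Dec (Pattern R u x y z w)
pattern? R? u x y z w =
  R? (u , x) (y , z) ×-dec
  ((R? (u , y) (x , z) ×-dec (R? (u , z) (x , y) ⊎-dec R? (u , z) (x , w))) ⊎-dec
   (R? (u , y) (x , w) ×-dec (R? (u , z) (y , w) ⊎-dec R? (x , z) (y , w))))

SameColour : ∀ {A C : Set} → (A → A → C) → A × A → A × A → Set
SameColour c (a , b) (a′ , b′) = c a b ≡ c a′ b′

-- Each conclusion is an equation, not a negation, and the diagonal and degenerate patterns are
-- included: in a product, distinct vertices may agree in one coordinate.
record Good {A C : Set} (c : A → A → C) : Set where
  field
    comm   : ∀ x y → c x y ≡ c y x
    cancel : ∀ x {y z} → c x y ≡ c x z → y ≡ z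
    avoid  : ∀ u x y z w → Pattern (SameColour c) u x y z w → x ≡ y

Good-pullback : ∀ {A B C : Set} {c : B → B → C} (f : A → B) → (∀ {a b} → f a ≡ f b → a ≡ b) →
                Good c → Good (λ x y → c (f x) (f y))
Good-pullback {c = c} f inj g = record
  { comm   = λ x y → comm (f x) (f y)
  ; cancel = λ x → inj ∘ cancel (f x)
  ; avoid  = λ u x y z w → inj ∘ avoid (f u) (f x) (f y) (f z) (f w) ∘
             Pattern-map {R = SameColour (λ x y → c (f x) (f y))} {S = SameColour c} f (λ p → p)
  }
  where open Good g

-- Counting repeated colours

module _ {E : Set} (R : E → E → Set) where
  -- At least k positions of the list have a later R-partner.
  Repeats : ℕ → List E → Set
  Repeats zero    _        = ⊤
  Repeats (suc k) []       = ⊥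
  Repeats (suc k) (x ∷ xs) = (Any (R x) xs × Repeats k xs) ⊎ Repeats (suc k) xs

length-filter-≢ : ∀ {m} (x : Fin m) {ys} → Unique ys →
                  length ys ≤ suc (length (filter (¬? ∘ (x ≟_)) ys))
length-filter-≢ x [] = z≤n
length-filter-≢ x {y ∷ ys} (y∉ys ∷ u) with x ≟ y
... | no _     = s≤s (length-filter-≢ x u)
... | yes refl = s≤s (≤-reflexive (cong length (sym (filter-all (¬? ∘ (x ≟_)) y∉ys))))

module _ {E : Set} {m} (κ : E → Fin m) where
  open import Data.List.Relation.Unary.Unique.DecPropositional.Properties (_≟_ {m})
    using (deduplicate-!)

  colours : List E → List (Fin m)
  colours = deduplicate _≟_ ∘ map κ

  -- Each colour has exactly one last occurrence in the list, and every other position has a later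
  -- partner of its colour.
  manyRepeats : ∀ k xs → length (colours xs) + k ≤ length xs → Repeats (λ e f → κ e ≡ κ f) k xs
  manyRepeats zero    xs       _ = tt
  manyRepeats (suc k) (x ∷ xs) h with Any.any? (λ f → κ x ≟ κ f) xs
  ... | yes p = inj₁ (p , manyRepeats k xs (begin
    length (colours xs) + k                ≤⟨ +-monoˡ-≤ k (length-filter-≢ (κ x) (deduplicate-! (map κ xs))) ⟩
    length (colours (x ∷ xs)) + k          ≤⟨ s≤s⁻¹ (≤-trans (≤-reflexive (sym (+-suc _ k))) h) ⟩
    length xs                              ∎))
    where open ≤-Reasoning
  ... | no ¬p = inj₂ (manyRepeats (suc k) xs (begin
    length (colours xs) + suc k            ≡⟨ cong (λ l → length l + suc k) (filter-all (¬? ∘ (κ x ≟_)) new) ⟨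
    length (filter (¬? ∘ (κ x ≟_)) (colours xs)) + suc k
                                           ≤⟨ s≤s⁻¹ h ⟩
    length xs                              ∎))
    where
    open ≤-Reasoning
    new : All (λ y → ¬ κ x ≡ y) (colours xs)
    new = All.deduplicate⁺ _≟_ (All.map⁺ (All.¬Any⇒All¬ xs ¬p))

-- Finite refutation of three coincidences in `K_5`

Edge : Set
Edge = Fin 5 × Fin 5

_≟ᴱ_ : (e f : Edge) → Dec (e ≡ f)
_≟ᴱ_ = ≡-dec _≟_ _≟_

sort : Edge → Edge
sort (i , j) = if toℕ i ≤ᵇ toℕ j then (i , j) else (j , i)

Links : Set
Links = List (Edge × Edge)

link : Edge → Edge → Links → Links
link e f S = (e , f) ∷ (f , e) ∷ S

Linked : Links → Edge → Edge → Set
Linked S e f = (sort e , sort f) ∈ S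

linked? : ∀ S e f → Dec (Linked S e f)
linked? S e f = Any.any? (≡-dec _≟ᴱ_ _≟ᴱ_ (sort e , sort f)) S

Adjacent : Edge → Edge → Set
Adjacent (i , j) (k , l) =
  ((i ≡ k × ¬ j ≡ l) ⊎ (j ≡ l × ¬ i ≡ k)) ⊎ ((i ≡ l × ¬ j ≡ k) ⊎ (j ≡ k × ¬ i ≡ l))

adjacent? : ∀ e f → Dec (Adjacent e f)
adjacent? (i , j) (k , l) =
  ((i ≟ k ×-dec ¬? (j ≟ l)) ⊎-dec (j ≟ l ×-dec ¬? (i ≟ k))) ⊎-dec
  ((i ≟ l ×-dec ¬? (j ≟ k)) ⊎-dec (j ≟ k ×-dec ¬? (i ≟ l)))

-- One step of transitivity suffices: in `K_5` two distinct edges disjoint from a third one share a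
-- vertex, so a third edge in a colour class is always detected.
Clash : Edge → Edge → Links → Set
Clash e f S =
  Adjacent e f ⊎ Any (λ (p , q) → (p ≡ e × Adjacent q f) ⊎ (p ≡ f × Adjacent q e)) S

clash? : ∀ e f S → Dec (Clash e f S)
clash? e f S = adjacent? e f ⊎-dec
  Any.any? (λ (p , q) → (p ≟ᴱ e ×-dec adjacent? q f) ⊎-dec (p ≟ᴱ f ×-dec adjacent? q e)) S

-- For four distinct vertices, w is the fifth one.
PatternAt : Links → Edge → Edge → Set
PatternAt S (u , x) (y , z) = ¬ x ≡ y × Pattern (Linked S) u x y z w
  where w = (10 ∸ (toℕ u + toℕ x + toℕ y + toℕ z)) mod 5

patternAt? : ∀ S e f → Dec (PatternAt S e f)
patternAt? S (u , x) (y , z) = ¬? (x ≟ y) ×-dec pattern? (linked? S) u x y z _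

-- An entry of `S` supplies u, x, y, z. As `link` stores both orders, reversing either edge covers
-- all eight labellings of a pair of disjoint edges.
HasPattern : Links → Set
HasPattern S = Any (λ (e , f) → (PatternAt S e f ⊎ PatternAt S (swap e) f) ⊎
                                (PatternAt S e (swap f) ⊎ PatternAt S (swap e) (swap f))) S

hasPattern? : ∀ S → Dec (HasPattern S)
hasPattern? S = Any.any? (λ (e , f) →
  (patternAt? S e f ⊎-dec patternAt? S (swap e) f) ⊎-dec
  (patternAt? S e (swap f) ⊎-dec patternAt? S (swap e) (swap f))) S

-- Every way of giving k elements of the list later partners of the same colour leads, together
-- with the coincidences S, to two adjacent edges of one colour or to one of the four patterns.
Refuted : Links → ℕ → List Edge → Set
Refuted S zero    _        = HasPattern S
Refuted S (suc k) []       = ⊤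
Refuted S (suc k) (x ∷ xs) =
  All (λ f → Clash x f S ⊎ Refuted (link x f S) k xs) xs × Refuted S (suc k) xs

refuted? : ∀ S k xs → Dec (Refuted S k xs)
refuted? S zero    _        = hasPattern? S
refuted? S (suc k) []       = yes tt
refuted? S (suc k) (x ∷ xs) =
  All.all? (λ f → clash? x f S ⊎-dec refuted? (link x f S) k xs) xs ×-dec
  refuted? S (suc k) xs

-- Decided by evaluation. The choices that survive `Clash` are three disjoint pairs of disjoint
-- edges, and each of these shows a pattern.
threeRefuted : Refuted [] 3 edgesK5
threeRefuted = from-yes (refuted? [] 3 edgesK5)

module _ {C : Set} {c : Fin 5 → Fin 5 → C} (good : Good c) where
  open Good good

  colourOf : Edge → C
  colourOf (i , j) = c i j

  Holds : Links → Set
  Holds = All (λ (e , f) → colourOf e ≡ colourOf f)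

  colourOf-sort : ∀ e → colourOf (sort e) ≡ colourOf e
  colourOf-sort (i , j) with toℕ i ≤ᵇ toℕ j
  ... | true  = refl
  ... | false = comm j i

  adjacent⇒≢ : ∀ {e f} → Adjacent e f → colourOf e ≢ colourOf f
  adjacent⇒≢ {i , j} (inj₁ (inj₁ (refl , j≢l))) eq = j≢l (cancel i eq)
  adjacent⇒≢ {i , j} {k , _} (inj₁ (inj₂ (refl , i≢k))) eq =
    i≢k (cancel j (trans (comm j i) (trans eq (comm k j))))
  adjacent⇒≢ {i , j} {k , _} (inj₂ (inj₁ (refl , j≢k))) eq = j≢k (cancel i (trans eq (comm k i)))
  adjacent⇒≢ {i , j} (inj₂ (inj₂ (refl , i≢l))) eq = i≢l (cancel j (trans (comm j i) eq))

  clash⇒≢ : ∀ {e f S} → Holds S → Clash e f S → colourOf e ≢ colourOf f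
  clash⇒≢ hS (inj₁ adj) = adjacent⇒≢ adj
  clash⇒≢ (eq ∷ _) (inj₂ (here (inj₁ (refl , adj)))) eq′ = adjacent⇒≢ adj (trans (sym eq) eq′)
  clash⇒≢ (eq ∷ _) (inj₂ (here (inj₂ (refl , adj)))) eq′ =
    adjacent⇒≢ adj (trans (sym eq) (sym eq′))
  clash⇒≢ (_ ∷ hS) (inj₂ (there p))                  eq′ = clash⇒≢ hS (inj₂ p) eq′

  linked⇒≡ : ∀ {e f S} → Holds S → Linked S e f → colourOf e ≡ colourOf f
  linked⇒≡ {e} {f} hS l =
    trans (sym (colourOf-sort e)) (trans (All.lookup hS l) (colourOf-sort f))

  ¬patternAt : ∀ {S} → Holds S → ∀ e f → ¬ PatternAt S e f
  ¬patternAt {S} hS (u , x) (y , z) (x≢y , p) = x≢y (avoid u x y z _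
    (Pattern-map {R = Linked S} {S = SameColour c} (λ i → i) (linked⇒≡ hS) p))

  ¬hasPattern : ∀ {S} → Holds S → ¬ HasPattern S
  ¬hasPattern hS p with Any.satisfied p
  ... | (e , f) , inj₁ (inj₁ q) = ¬patternAt hS e f q
  ... | (e , f) , inj₁ (inj₂ q) = ¬patternAt hS (swap e) f q
  ... | (e , f) , inj₂ (inj₁ q) = ¬patternAt hS e (swap f) q
  ... | (e , f) , inj₂ (inj₂ q) = ¬patternAt hS (swap e) (swap f) q

  refuted⇒¬repeats : ∀ {S} k xs → Holds S → Refuted S k xs →
                     ¬ Repeats (λ e f → colourOf e ≡ colourOf f) k xs
  refuted⇒¬repeats zero    xs       hS ref _ = ¬hasPattern hS ref
  refuted⇒¬repeats (suc k) (x ∷ xs) hS (_ , ref) (inj₂ rep) = refuted⇒¬repeats (suc k) xs hS ref rep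
  refuted⇒¬repeats (suc k) (x ∷ xs) hS (all , _) (inj₁ (any , rep)) with All.lookupAny all any
  ... | inj₁ clash , eq = clash⇒≢ hS clash eq
  ... | inj₂ ref   , eq = refuted⇒¬repeats k xs (eq ∷ sym eq ∷ hS) ref rep

eightColours : ∀ {m} {c : Fin 5 → Fin 5 → Fin m} (good : Good c) →
               8 ≤ length (colours (colourOf good) edgesK5)
eightColours good with 8 ≤? length (colours (colourOf good) edgesK5)
... | yes p = p
-- Ten edges with at most 7 colours have three repeats.
... | no ¬p = contradiction (manyRepeats (colourOf good) 3 edgesK5 (+-monoˡ-≤ 3 (s≤s⁻¹ (≰⇒> ¬p))))
                (refuted⇒¬repeats good 3 edgesK5 [] threeRefuted)

-- Good sizes and their products

GoodSize : ℕ → Set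
GoodSize n = Σ (Fin n → Fin n → Fin n) Good

goodSize⇒f5≤ : ∀ {m n} → GoodSize m → n ≤ m → f5≤ n 8 m
goodSize⇒f5≤ (c , good) n≤m =
  ((λ i j → c (inject≤ i n≤m) (inject≤ j n≤m)) , λ i j → Good.comm good _ _) ,
  λ v v-inj → eightColours (Good-pullback (λ i → inject≤ (v i) n≤m)
    (λ {i} {j} → v-inj i j ∘ inject≤-injective n≤m n≤m (v i) (v j)) good)

goodSize-1 : GoodSize 1
goodSize-1 = (λ _ _ → zero) , record
  { comm   = λ _ _ → refl
  ; cancel = λ { _ {zero} {zero} _ → refl }
  ; avoid  = λ { _ zero zero _ _ _ → refl }
  }

-- Equal colours project to equal colours in both coordinates, and a vertex is determined by its
-- coordinates.
goodSize-* : ∀ {m n} → GoodSize m → GoodSize n → GoodSize (m * n)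
goodSize-* {m} {n} (c , good-c) (d , good-d) = _∙_ , record
  { comm   = λ x y → cong₂ combine (Good.comm good-c (π₁ x) (π₁ y)) (Good.comm good-d (π₂ x) (π₂ y))
  ; cancel = λ x {y} {z} eq → ext (Good.cancel good-c (π₁ x) (∙-π₁ {x} {y} {x} {z} eq))
                                  (Good.cancel good-d (π₂ x) (∙-π₂ {x} {y} {x} {z} eq))
  ; avoid  = λ u x y z w p → ext
      (Good.avoid good-c _ _ _ _ _ (Pattern-map {R = SameColour _∙_} {SameColour c} π₁
        (λ {a} {b} {a′} {b′} → ∙-π₁ {a} {b} {a′} {b′}) p))
      (Good.avoid good-d _ _ _ _ _ (Pattern-map {R = SameColour _∙_} {SameColour d} π₂
        (λ {a} {b} {a′} {b′} → ∙-π₂ {a} {b} {a′} {b′}) p))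
  }
  where
  π₁ : Fin (m * n) → Fin m
  π₁ = proj₁ ∘ remQuot n
  π₂ : Fin (m * n) → Fin n
  π₂ = proj₂ ∘ remQuot {m} n
  _∙_ : Fin (m * n) → Fin (m * n) → Fin (m * n)
  x ∙ y = combine (c (π₁ x) (π₁ y)) (d (π₂ x) (π₂ y))
  ext : ∀ {x y} → π₁ x ≡ π₁ y → π₂ x ≡ π₂ y → x ≡ y
  ext {x} {y} eq₁ eq₂ = trans (sym (combine-remQuot {m} n x))
    (trans (cong₂ combine eq₁ eq₂) (combine-remQuot {m} n y))
  ∙-π₁ : ∀ {x y x′ y′} → x ∙ y ≡ x′ ∙ y′ → c (π₁ x) (π₁ y) ≡ c (π₁ x′) (π₁ y′)
  ∙-π₁ = combine-injectiveˡ _ _ _ _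
  ∙-π₂ : ∀ {x y x′ y′} → x ∙ y ≡ x′ ∙ y′ → d (π₂ x) (π₂ y) ≡ d (π₂ x′) (π₂ y′)
  ∙-π₂ = combine-injectiveʳ (c _ _) (d _ _) (c _ _) (d _ _)

-- Colourings from quadratic residues

module _ (r a : ℕ) (squares : List ℕ) where

  private
    q : ℕ
    q = suc r

  -- `q ∸ x` and `suc q ∸ a` represent -x and 1 - a modulo q when x and a are at most q. With 0 not
  -- listed among the squares, the diagonal colour of x is x itself.
  numerator : ℕ → ℕ → ℕ
  numerator x y =
    if any (_≡ᵇ (y + (q ∸ x)) % q) squares
    then a * y + (suc q ∸ a) * x
    else a * x + (suc q ∸ a) * y

  residueColour : Fin q → Fin q → Fin q
  residueColour i j = numerator (toℕ i) (toℕ j) mod q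

  -- Translation by -1, an automorphism, which reduces the checks to a first vertex 0.
  rotate : Fin q → Fin q
  rotate i = (toℕ i + r) mod q

  private
    _∙_ = residueColour
    _∙ℕ_ : ℕ → ℕ → ℕ
    x ∙ℕ y = numerator x y % q

  -- The first conjunct of `Pattern` is repeated ahead of w to shorten the search: by cancellation,
  -- given x and y, at most one z reaches the loop over w.
  Checked : Set
  Checked = (∀ x y → x ∙ y ≡ y ∙ x) ×
            (∀ y z → zero ∙ y ≡ zero ∙ z → y ≡ z) ×
            (∀ x y → rotate x ∙ rotate y ≡ rotate (x ∙ y)) ×
            (∀ x y → rotate x ≡ rotate y → x ≡ y) ×
            (∀ i → rotate (suc i) ≡ inject₁ i) ×
            (∀ {x} → x < q → ∀ {y} → y < q → ∀ {z} → z < q → 0 ∙ℕ x ≡ y ∙ℕ z →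
             ∀ {w} → w < q → Pattern (SameColour _∙ℕ_) 0 x y z w → x ≡ y)

  checked? : Dec Checked
  checked? =
    (all? λ x → all? λ y → x ∙ y ≟ y ∙ x) ×-dec
    (all? λ y → all? λ z → zero ∙ y ≟ zero ∙ z →-dec y ≟ z) ×-dec
    (all? λ x → all? λ y → rotate x ∙ rotate y ≟ rotate (x ∙ y)) ×-dec
    (all? λ x → all? λ y → rotate x ≟ rotate y →-dec x ≟ y) ×-dec
    (all? λ i → rotate (suc i) ≟ inject₁ i) ×-dec
    (below? λ x → below? λ y → below? λ z → (0 ∙ℕ x) ℕ.≟ (y ∙ℕ z) →-dec below? λ w →
      pattern? (λ (s , t) (s′ , t′) → (s ∙ℕ t) ℕ.≟ (s′ ∙ℕ t′)) 0 x y z w →-dec x ℕ.≟ y)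
    where
    below? : ∀ {P : ℕ → Set} → Decidable P → Dec (∀ {n} → n < q → P n)
    below? P? = allUpTo? P? q

  -- Induction on the first vertex: `rotate` takes `suc i` to `inject₁ i` and preserves
  -- coincidences, and its injectivity carries the conclusion back.
  residueGood : Checked → GoodSize q
  residueGood (comm , cancel₀ , rotate-∙ , rotate-inj , rotate-suc , avoid₀) = _∙_ , record
    { comm   = comm
    ; cancel = λ x {y} {z} → <-weakInduction Cancel cancel₀ cancel-step x y z
    ; avoid  = <-weakInduction Avoid avoid-zero avoid-step
    }
    where
    Cancel : Fin q → Set
    Cancel x = ∀ y z → x ∙ y ≡ x ∙ z → y ≡ z
    Avoid : Fin q → Set
    Avoid u = ∀ x y z w → Pattern (SameColour _∙_) u x y z w → x ≡ y
    toℕ-∙ : ∀ s t → toℕ (s ∙ t) ≡ toℕ s ∙ℕ toℕ t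
    toℕ-∙ s t = toℕ-fromℕ< _
    toℕ-≡ : ∀ {s t s′ t′} → s ∙ t ≡ s′ ∙ t′ → toℕ s ∙ℕ toℕ t ≡ toℕ s′ ∙ℕ toℕ t′
    toℕ-≡ {s} {t} {s′} {t′} eq = trans (sym (toℕ-∙ s t)) (trans (cong toℕ eq) (toℕ-∙ s′ t′))
    avoid-zero : Avoid zero
    avoid-zero x y z w p = toℕ-injective
      (avoid₀ (toℕ<n x) (toℕ<n y) (toℕ<n z) (proj₁ p′) (toℕ<n w) p′)
      where
      p′ : Pattern (SameColour _∙ℕ_) 0 (toℕ x) (toℕ y) (toℕ z) (toℕ w)
      p′ = Pattern-map {R = SameColour _∙_} {S = SameColour _∙ℕ_} toℕ
             (λ {s} {t} {s′} {t′} → toℕ-≡ {s} {t} {s′} {t′}) p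
    rotate-≡ : ∀ {s t s′ t′} → s ∙ t ≡ s′ ∙ t′ → rotate s ∙ rotate t ≡ rotate s′ ∙ rotate t′
    rotate-≡ {s} {t} {s′} {t′} eq =
      trans (rotate-∙ s t) (trans (cong rotate eq) (sym (rotate-∙ s′ t′)))
    cancel-step : ∀ i → Cancel (inject₁ i) → Cancel (suc i)
    cancel-step i ih y z eq = rotate-inj y z (ih (rotate y) (rotate z)
      (subst (λ x → x ∙ rotate y ≡ x ∙ rotate z) (rotate-suc i) (rotate-≡ {suc i} {y} {suc i} {z} eq)))
    avoid-step : ∀ i → Avoid (inject₁ i) → Avoid (suc i)
    avoid-step i ih x y z w p = rotate-inj x y (ih _ _ (rotate z) (rotate w)
      (subst (λ u → Pattern (SameColour _∙_) u (rotate x) (rotate y) (rotate z) (rotate w)) (rotate-suc i)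
        (Pattern-map {R = SameColour _∙_} {S = SameColour _∙_} rotate
          (λ {s} {t} {s′} {t′} → rotate-≡ {s} {t} {s′} {t′}) p)))

goodSize-11 : GoodSize 11
goodSize-11 = residueGood 10 2 squares (from-yes (checked? 10 2 squares))
  where
  squares : List ℕ
  squares = 1 ∷ 3 ∷ 4 ∷ 5 ∷ 9 ∷ []

goodSize-23 : GoodSize 23
goodSize-23 = residueGood 22 6 squares (from-yes (checked? 22 6 squares))
  where
  squares : List ℕ
  squares = 1 ∷ 2 ∷ 3 ∷ 4 ∷ 6 ∷ 8 ∷ 9 ∷ 12 ∷ 13 ∷ 16 ∷ 18 ∷ []

-- Density of 11^i 23^j

-- A discrete intermediate value argument: search downwards for the first s with `h s ≤ n`.
crossing : ∀ (h : ℕ → ℕ) {n} S → h 0 ≤ n → n ≤ h (suc S) →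
           Σ ℕ λ s → (s ≤ S) × (h s ≤ n) × (n ≤ h (suc s))
crossing h zero    lo hi = 0 , z≤n , lo , hi
crossing h {n} (suc S) lo hi with h (suc S) ≤? n
... | yes p = suc S , ≤-refl , p , hi
... | no ¬p with crossing h S lo (<⇒≤ (≰⇒> ¬p))
...   | s , s≤S , l , u = s , m≤n⇒m≤1+n s≤S , l , u

n<b^n : ∀ {b} → 2 ≤ b → ∀ n → n < b ^ n
n<b^n 2≤b zero = s≤s z≤n
n<b^n {b} 2≤b (suc n) = begin-strict
  suc n       ≤⟨ n<b^n 2≤b n ⟩
  b ^ n       <⟨ m<m*n (b ^ n) b {{>-nonZero (≤-<-trans z≤n (n<b^n 2≤b n))}} 2≤b ⟩
  b ^ n * b   ≡⟨ *-comm (b ^ n) b ⟩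
  b ^ suc n   ∎
  where open ≤-Reasoning

-- Bernoulli's inequality `1 + S/B ≤ (1 + 1/B)^S`, cleared of denominators.
bernoulli : ∀ B S → (B + S) * B ^ S ≤ B * suc B ^ S
bernoulli B zero = ≤-reflexive (cong (_* 1) (+-identityʳ B))
bernoulli B (suc S) = begin
  (B + suc S) * (B * B ^ S)                   ≤⟨ m≤m+n _ (S * B ^ S) ⟩
  (B + suc S) * (B * B ^ S) + S * B ^ S       ≡⟨ rearrange B S (B ^ S) ⟩
  suc B * ((B + S) * B ^ S)                   ≤⟨ *-monoʳ-≤ (suc B) (bernoulli B S) ⟩
  suc B * (B * suc B ^ S)                     ≡⟨ leftComm (suc B) B (suc B ^ S) ⟩
  B * suc B ^ suc S                           ∎
  where
  open ≤-Reasoning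
  rearrange : ∀ b s e → (b + suc s) * (b * e) + s * e ≡ suc b * ((b + s) * e)
  rearrange = solve-∀
  leftComm : ∀ a b e → a * (b * e) ≡ b * (a * e)
  leftComm = solve-∀

-- Since `A/B ≥ 1 + 1/B`, Bernoulli with exponent `b * B` gives `(A/B)^(b * B) ≥ 1 + b`.
powersOvertake : ∀ {A B} b → 0 < B → B < A → b * B ^ (b * B) ≤ A ^ (b * B)
powersOvertake {A} {B} b 0<B B<A = ≤-trans (*-cancelˡ-≤ B {{>-nonZero 0<B}} (begin
  B * (b * B ^ S)      ≡⟨ sym (*-assoc B b (B ^ S)) ⟩
  B * b * B ^ S        ≡⟨ cong (_* B ^ S) (*-comm B b) ⟩
  S * B ^ S            ≤⟨ *-monoˡ-≤ (B ^ S) (m≤n+m S B) ⟩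
  (B + S) * B ^ S      ≤⟨ bernoulli B S ⟩
  B * suc B ^ S        ∎)) (^-monoˡ-≤ S B<A)
  where
  S = b * B
  open ≤-Reasoning

CloseAbove : ℕ → ℕ → ℕ → Set
CloseAbove k B A = (B < A) × (suc k * A ≤ suc (suc k) * B)

-- Close products of powers, and rounding up to them

module _ (a b : ℕ) (2≤a : 2 ≤ a) (2≤b : 2 ≤ b)
         (independent : ∀ p i j → a ^ suc p * b ^ i ≢ b ^ j) where

  instance
    b≢0 : NonZero b
    b≢0 = >-nonZero (≤-trans (s≤s z≤n) 2≤b)

  0<a^ : ∀ i → 0 < a ^ i
  0<a^ i = ≤-<-trans z≤n (n<b^n 2≤a i)

  module Rounding (e : ℕ → ℕ) (b^e≤a^ : ∀ i → b ^ e i ≤ a ^ i)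
                  (a^≤b^1+e : ∀ i → a ^ i ≤ b ^ suc (e i)) (k : ℕ) where

    instance
      b^e≢0 : ∀ {i} → NonZero (b ^ e i)
      b^e≢0 {i} = m^n≢0 b (e i)

    K : ℕ
    K = suc k

    -- The quotients `a^i / b^(e i)` lie between 1 and b; the level names the cell of width 1/K
    -- containing the quotient.
    level : ℕ → ℕ
    level i = K * a ^ i / b ^ e i

    level≤ : ∀ i → level i < suc (K * b)
    level≤ i = s≤s (begin
      K * a ^ i / b ^ e i            ≤⟨ /-monoˡ-≤ (b ^ e i) (*-monoʳ-≤ K (a^≤b^1+e i)) ⟩
      K * (b * b ^ e i) / b ^ e i    ≡⟨ cong (_/ b ^ e i) (sym (*-assoc K b (b ^ e i))) ⟩
      K * b * b ^ e i / b ^ e i      ≡⟨ m*n/n≡m (K * b) (b ^ e i) ⟩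
      K * b                          ∎)
      where open ≤-Reasoning

    -- Equal integer parts of K a^i / b^(e i) make the two quotients differ by less than 1, hence
    -- by a factor at most 1 + 1/K since each is at least K.
    sameLevel⇒close : ∀ i i′ → level i ≡ level i′ →
                      K * (a ^ i * b ^ e i′) ≤ suc K * (a ^ i′ * b ^ e i)
    sameLevel⇒close i i′ same = begin
      K * (X * Y′)                      ≡⟨ sym (*-assoc K X Y′) ⟩
      K * X * Y′                        ≡⟨ cong (_* Y′) (m≡m%n+[m/n]*n (K * X) Y) ⟩
      (K * X % Y + level i * Y) * Y′    ≤⟨ *-monoˡ-≤ Y′ (+-monoˡ-≤ (level i * Y) (<⇒≤ (m%n<n (K * X) Y))) ⟩
      (Y + level i * Y) * Y′            ≡⟨ cong (λ l → (Y + l * Y) * Y′) same ⟩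
      (Y + level i′ * Y) * Y′           ≡⟨ regroup Y Y′ (level i′) ⟩
      Y′ * Y + level i′ * Y′ * Y        ≤⟨ +-monoʳ-≤ (Y′ * Y) (*-monoˡ-≤ Y (m≤n+m _ (K * X′ % Y′))) ⟩
      Y′ * Y + (K * X′ % Y′ + level i′ * Y′) * Y
                                        ≡⟨ cong (λ l → Y′ * Y + l * Y) (sym (m≡m%n+[m/n]*n (K * X′) Y′)) ⟩
      Y′ * Y + K * X′ * Y               ≤⟨ +-monoˡ-≤ (K * X′ * Y) (*-monoˡ-≤ Y (b^e≤a^ i′)) ⟩
      X′ * Y + K * X′ * Y               ≡⟨ cong (X′ * Y +_) (*-assoc K X′ Y) ⟩
      suc K * (X′ * Y)                  ∎
      where
      open ≤-Reasoning
      X = a ^ i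
      X′ = a ^ i′
      Y = b ^ e i
      Y′ = b ^ e i′
      regroup : ∀ y y′ l → (y + l * y) * y′ ≡ y′ * y + l * y′ * y
      regroup = solve-∀

    -- Cancelling `a ^ i` from an equality would contradict independence.
    quotients-distinct : ∀ {i i′} → i < i′ → a ^ i′ * b ^ e i ≢ a ^ i * b ^ e i′
    quotients-distinct {i} {i′} i<i′ eq = independent p (e i) (e i′)
      (*-cancelˡ-≡ _ _ (a ^ i) {{>-nonZero (0<a^ i)}} (begin
        a ^ i * (a ^ suc p * b ^ e i)   ≡⟨ sym (*-assoc (a ^ i) _ _) ⟩
        a ^ i * a ^ suc p * b ^ e i     ≡⟨ cong (_* b ^ e i) (sym (^-distribˡ-+-* a i (suc p))) ⟩
        a ^ (i + suc p) * b ^ e i       ≡⟨ cong (λ t → a ^ t * b ^ e i) (trans (+-suc i p) (m+[n∸m]≡n i<i′)) ⟩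
        a ^ i′ * b ^ e i                ≡⟨ eq ⟩
        a ^ i * b ^ e i′                ∎))
      where
      open ≡-Reasoning
      p = i′ ∸ suc i

    -- Dirichlet's argument: `K * b + 2` indices share `K * b + 1` levels. Two quotients on one
    -- level are cross-multiplied into products of powers, and the larger one is taken as the upper
    -- number.
    closePair : ∃₂ λ i j → ∃₂ λ i′ j′ → CloseAbove k (a ^ i * b ^ j) (a ^ i′ * b ^ j′)
    closePair with pigeonhole {suc (K * b)} {suc (suc (K * b))} (n<1+n _)
                     (λ f → fromℕ< (level≤ (toℕ f)))
    ... | f , f′ , f<f′ , same′ =
      compare (<-cmp (a ^ i′ * b ^ e i) (a ^ i * b ^ e i′))
      where
      i = toℕ f
      i′ = toℕ f′
      same : level i ≡ level i′
      same = trans (sym (toℕ-fromℕ< (level≤ i)))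
               (trans (cong toℕ same′) (toℕ-fromℕ< (level≤ i′)))
      compare : Tri (a ^ i′ * b ^ e i < a ^ i * b ^ e i′) (a ^ i′ * b ^ e i ≡ a ^ i * b ^ e i′)
                    (a ^ i′ * b ^ e i > a ^ i * b ^ e i′) →
                ∃₂ λ i j → ∃₂ λ i′ j′ → CloseAbove k (a ^ i * b ^ j) (a ^ i′ * b ^ j′)
      compare (tri< lt _ _) = i′ , e i , i , e i′ , lt , sameLevel⇒close i i′ same
      compare (tri≈ _ eq _) = contradiction eq (quotients-distinct f<f′)
      compare (tri> _ _ gt) = i , e i′ , i′ , e i , gt , sameLevel⇒close i′ i (sym same)

  exponent : ∀ i → Σ ℕ λ j → (b ^ j ≤ a ^ i) × (a ^ i ≤ b ^ suc j)
  exponent i with crossing (b ^_) (a ^ i) (0<a^ i)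
                   (<⇒≤ (<-trans (n<1+n _) (n<b^n 2≤b (suc (a ^ i)))))
  ... | j , _ , l , u = j , l , u

  closeQuotient : ∀ k → ∃₂ λ i j → ∃₂ λ i′ j′ →
                  CloseAbove k (a ^ i * b ^ j) (a ^ i′ * b ^ j′)
  closeQuotient = Rounding.closePair (λ i → proj₁ (exponent i))
    (λ i → proj₁ (proj₂ (exponent i))) (λ i → proj₂ (proj₂ (exponent i)))

  module _ {ℓ} (M : ℕ → Set ℓ) (M-1 : M 1) (M-* : ∀ {m n} → M m → M n → M (m * n))
           (M-a : M a) (M-b : M b) where

    M-^ : ∀ {m} → M m → ∀ s → M (m ^ s)
    M-^ Mm zero    = M-1
    M-^ Mm (suc s) = M-* Mm (M-^ Mm s)

    -- The numbers C A^s B^(S-s) rise from C B^S to C A^S by factors A/B.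
    climb : ∀ {k A B} → CloseAbove k B A → 0 < B → M A → M B → ∀ S {C} → M C → ∀ {n} →
            C * B ^ S ≤ n → n ≤ C * A ^ S → Σ ℕ λ m → M m × (n ≤ m) × (suc k * m ≤ suc k * n + n)
    climb {k} _ _ _ _ zero {C} M-C {n} lo hi =
      C * 1 , M-* M-C M-1 , hi , ≤-trans (*-monoʳ-≤ (suc k) lo) (m≤m+n _ n)
    climb {k} {A} {B} close 0<B M-A M-B (suc S) {C} M-C {n} lo hi with n ≤? C * A * B ^ S
    ... | no ≰ = climb {k} close 0<B M-A M-B S (M-* M-C M-A) (<⇒≤ (≰⇒> ≰))
                   (≤-trans hi (≤-reflexive (sym (*-assoc C A (A ^ S)))))
    ... | yes n≤ = C * A * B ^ S , M-* (M-* M-C M-A) (M-^ M-B S) , n≤ , (begin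
      suc k * (C * A * B ^ S)         ≡⟨ regroup (suc k) C A (B ^ S) ⟩
      C * B ^ S * (suc k * A)         ≤⟨ *-monoʳ-≤ (C * B ^ S) (proj₂ close) ⟩
      C * B ^ S * (suc (suc k) * B)   ≡⟨ regroup′ (suc (suc k)) C B (B ^ S) ⟩
      suc (suc k) * (C * (B * B ^ S)) ≤⟨ *-monoʳ-≤ (suc (suc k)) lo ⟩
      suc (suc k) * n                 ≡⟨ +-comm n (suc k * n) ⟩
      suc k * n + n                   ∎)
      where
      open ≤-Reasoning
      regroup : ∀ k c a x → k * (c * a * x) ≡ c * x * (k * a)
      regroup = solve-∀
      regroup′ : ∀ k c b x → c * x * (k * b) ≡ k * (c * (b * x))
      regroup′ = solve-∀

    -- The intervals from `b^D * B^S` to `b^(D+1) * B^S` cover all n from `B^S` on. As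
    -- `b * B^S ≤ A^S`, the climb from `b^D * B^S` to `b^D * A^S` spans the interval containing n.
    fromClose : ∀ {k A B} → CloseAbove k B A → 0 < B → M A → M B → Σ ℕ λ N → ∀ n → N ≤ n →
                Σ ℕ λ m → M m × (n ≤ m) × (suc k * m ≤ suc k * n + n)
    fromClose {k} {A} {B} close 0<B M-A M-B = B ^ S , above
      where
      S = b * B
      leftComm′ : ∀ x y z → x * y * z ≡ y * (x * z)
      leftComm′ = solve-∀
      above : ∀ n → B ^ S ≤ n → Σ ℕ λ m → M m × (n ≤ m) × (suc k * m ≤ suc k * n + n)
      above n N≤n with crossing (λ D → b ^ D * B ^ S) n
                         (≤-trans (≤-reflexive (*-identityˡ (B ^ S))) N≤n)
                         (≤-trans (<⇒≤ (<-trans (n<1+n n) (n<b^n 2≤b (suc n))))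
                                  (m≤m*n (b ^ suc n) (B ^ S) {{m^n≢0 B S {{>-nonZero 0<B}}}}))
      ... | D , _ , lo , hi =
        climb {k} close 0<B M-A M-B S (M-^ M-b D) lo
          (≤-trans hi (≤-trans (≤-reflexive (leftComm′ b (b ^ D) (B ^ S)))
            (*-monoʳ-≤ (b ^ D) (powersOvertake b 0<B (proj₁ close)))))

    dense : ∀ k → Σ ℕ λ N → ∀ n → N ≤ n →
            Σ ℕ λ m → M m × (n ≤ m) × (suc k * m ≤ suc k * n + n)
    dense k = start (closeQuotient k)
      where
      start : (∃₂ λ i j → ∃₂ λ i′ j′ → CloseAbove k (a ^ i * b ^ j) (a ^ i′ * b ^ j′)) →
              Σ ℕ λ N → ∀ n → N ≤ n → Σ ℕ λ m → M m × (n ≤ m) × (suc k * m ≤ suc k * n + n)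
      start (i , j , i′ , j′ , close) =
        fromClose {k} close
          (*-mono-< {0} {a ^ i} {0} {b ^ j} (0<a^ i) (≤-<-trans z≤n (n<b^n 2≤b j)))
          (M-* (M-^ M-a i′) (M-^ M-b j′)) (M-* (M-^ M-a i) (M-^ M-b j))

prime∣^⇒∣ : ∀ {p m} → Prime p → ∀ j → p ∣ m ^ j → p ∣ m
prime∣^⇒∣ pr zero p∣1 = contradiction (subst Prime (∣1⇒≡1 p∣1) pr) ¬prime[1]
prime∣^⇒∣ {m = m} pr (suc j) p∣ with euclidsLemma m (m ^ j) pr p∣
... | inj₁ p∣m   = p∣m
... | inj₂ p∣m^j = prime∣^⇒∣ pr j p∣m^j

-- The left side is divisible by 11, so 11 would divide 23.
11-23-independent : ∀ p i j → 11 ^ suc p * 23 ^ i ≢ 23 ^ j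
11-23-independent p i j eq = from-no (11 ∣? 23)
  (prime∣^⇒∣ (from-yes (prime? 11)) j
    (subst (11 ∣_) eq (∣-trans (m∣m*n (11 ^ p)) (m∣m*n (23 ^ i)))))

-- The error o(n) is expressed by excesses of at most `n / (k + 1)`, for each k and all large n; m
-- is a good size just above n.
theorem1p1 : (k : ℕ) → Σ ℕ (λ N → (n : ℕ) → N ≤ n →
    Σ ℕ (λ m → (suc k * m ≤ suc k * n + n) × f5≤ n 8 m))
theorem1p1 k = N , λ n N≤n →
  let m , good , n≤m , m≤ = above n N≤n in m , m≤ , goodSize⇒f5≤ good n≤m
  where
  goodSizes : Σ ℕ λ N → ∀ n → N ≤ n → Σ ℕ λ m → GoodSize m × (n ≤ m) × (suc k * m ≤ suc k * n + n)
  goodSizes = dense 11 23 (s≤s (s≤s z≤n)) (s≤s (s≤s z≤n)) 11-23-independent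
    GoodSize goodSize-1 goodSize-* goodSize-11 goodSize-23 k
  N = proj₁ goodSizes
  above = proj₂ goodSizes
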